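{- Let $P=\langle\mathbf{x},Q,q_{init},\Delta\rangle$ be an integer program. Let $[\![P]\!]^*_\sharp,[\![P]\!]^{TInv}_\sharp:Q\times Q\to2^{\mathbb{Z}^{\mathbf{x}}\times\mathbb{Z}^{\mathbf{x}}}$ be mappings with $[\![P]\!]^*_\sharp(q,q')\supseteq[\![P]\!]^*(q,q')$ and $[\![P]\!]^{TInv}_\sharp(q,q')\supseteq[\![P]\!]^{TInv}(q,q')$ for all $q,q'\in Q$. For each $q\in Q$ let $p_q\ge1$ and let $R_{q,1},\dots,R_{q,p_q}\subseteq\mathbb{Z}^{\mathbf{x}}\times\mathbb{Z}^{\mathbf{x}}$ be relations with $[\![P]\!]^{TInv}_\sharp(q,q)=\bigcup_{k=1}^{p_q}R_{q,k}$. Let $$\mathcal{N}=\bigcup_{q\in Q}\big([\![P]\!]^*_\sharp(q_{init},q)\big)^{ -1}\Big(\bigcup_{k=1}^{p_q}\mathrm{wnt}(R_{q,k})\Big).$$ Then $[\![P]\!]^{wnt}(q_{init})\subseteq\mathcal{N}$. Moreover, if $[\![P]\!]^{TInv}_\sharp=[\![P]\!]^{TInv}$ and $[\![P]\!]^*_\sharp=[\![P]\!]^*$, then $\mathcal{N}=[\![P]\!]^{wnt}(q_{init})$.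
   Context: An integer program is a tuple $P=\langle\mathbf{x},Q,q_{init},\Delta\rangle$ where $\mathbf{x}$ is a finite set of integer variables, $Q$ a finite set of control states, $q_{init}\in Q$, and $\Delta$ a finite set of transition rules $q\xrightarrow{R(\mathbf{x},\mathbf{x}')}q'$ with $R$ a quantifier-free Presburger formula over $\mathbf{x}$ and primed copies $\mathbf{x}'$. A configuration is a pair $\langle q,\nu\rangle$, $q\in Q$, $\nu\in\mathbb{Z}^{\mathbf{x}}$ (a valuation). $\langle q',\nu'\rangle$ is an immediate successor of $\langle q,\nu\rangle$ if some $q\xrightarrow{R}q'\in\Delta$ has $(\nu,\nu')\models R$. A run of length $k\ge0$ is a sequence of $k+1$ configurations, each an immediate successor of the previous; infinite runs are defined likewise. For $q,q'\in Q$: $[\![P]\!]^+(q,q')$ (resp. $[\![P]\!]^*(q,q')$) is the set of pairs $\langle\nu,\nu'\rangle$ such that there is a run of length $k\ge1$ (resp. $k\ge0$) from $\langle q,\nu\rangle$ to $\langle q',\nu'\rangle$; $[\![P]\!]^{wnt}(q)$ is the set of $\nu$ such that some infinite run starts in $\langle q,\nu\rangle$; and $[\![P]\!]^{TInv}(q,q')=\{\langle\nu,\nu'\rangle\in[\![P]\!]^+(q,q')\mid\nu\in([\![P]\!]^*(q_{init},q))(\mathbb{Z}^{\mathbf{x}})\}$. For a relation $\rho$ and a set $S$: $\rho(S)=\{\nu'\mid\exists\nu\in S.\ (\nu,\nu')\in\rho\}$ and $\rho^{ -1}(S)=\{\nu\mid\exists\nu'\in S.\ (\nu,\nu')\in\rho\}$.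 For a relation $R$ on $\mathbb{Z}^{\mathbf{x}}$, $\mathrm{wnt}(R)$ is the set of $\nu$ for which there is an infinite sequence $\nu=\nu_0,\nu_1,\dots$ with $(\nu_i,\nu_{i+1})\in R$ for all $i\ge0$. -}

module Defs where

open import Data.Fin.Base as Fin using (Fin; inject₁; fromℕ)
open import Data.Integer.Base as ℤ using (ℤ; +_)
open import Data.Integer.Divisibility as ℤ using ()
open import Data.List.Base using (List)
open import Data.List.Membership.Propositional using (_∈_)
open import Data.Nat.Base using (ℕ; zero; suc; _≤_; NonZero)
open import Data.Product.Base using (Σ-syntax; ∃-syntax; _×_; _,_)
open import Data.Sum.Base using (_⊎_; inj₁; inj₂)
open import Data.Vec.Base using (Vec; lookup)
open import Level using (0ℓ)
open import Relation.Binary.Core using (Rel)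
open import Relation.Binary.PropositionalEquality using (_≡_)
open import Relation.Nullary.Negation.Core using (¬_)
open import Relation.Unary using (Pred; U)

------------------------------------------------------------------------
-- Relations and sets

⋃ᴿ : {A I : Set} → (I → Rel A 0ℓ) → Rel A 0ℓ
⋃ᴿ R x y = ∃[ i ] R i x y

image : {A : Set} → Rel A 0ℓ → Pred A 0ℓ → Pred A 0ℓ
image R S y = ∃[ x ] S x × R x y

preimage : {A : Set} → Rel A 0ℓ → Pred A 0ℓ → Pred A 0ℓ
preimage R S x = ∃[ y ] S y × R x y

wnt : {A : Set} → Rel A 0ℓ → Pred A 0ℓ
wnt {A} R x = Σ[ s ∈ (ℕ → A) ] s 0 ≡ x × (∀ i → R (s i) (s (suc i)))

------------------------------------------------------------------------
-- Quantifier-free Presburger formulas over the variables x₁ … xₙ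
-- and their primed copies

infixl 7 _·_
infixl 6 _⊞_
infix  4 _≤ᶠ_ _=ᶠ_ _∣ᶠ_
infixr 3 _∧ᶠ_
infixr 2 _∨ᶠ_

data Term (n : ℕ) : Set where
  var  : Fin n → Term n
  var′ : Fin n → Term n
  con  : ℤ → Term n
  _⊞_  : Term n → Term n → Term n
  _·_  : ℤ → Term n → Term n

-- Divisibility by positive constants belongs to the language, as in the
-- version of Presburger arithmetic that admits quantifier elimination.
data Formula (n : ℕ) : Set where
  _≤ᶠ_ _=ᶠ_ : Term n → Term n → Formula n
  _∣ᶠ_      : (k : ℕ) .{{_ : NonZero k}} → Term n → Formula n
  ¬ᶠ_       : Formula n → Formula n
  _∧ᶠ_ _∨ᶠ_ : Formula n → Formula n → Formula n

Valuation : ℕ → Set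
Valuation n = Vec ℤ n

eval : ∀ {n} → Valuation n → Valuation n → Term n → ℤ
eval ν ν′ (var i)  = lookup ν i
eval ν ν′ (var′ i) = lookup ν′ i
eval ν ν′ (con a)  = a
eval ν ν′ (s ⊞ t)  = eval ν ν′ s ℤ.+ eval ν ν′ t
eval ν ν′ (a · t)  = a ℤ.* eval ν ν′ t

infix 4 _⊨_

_⊨_ : ∀ {n} → Valuation n × Valuation n → Formula n → Set
(ν , ν′) ⊨ (s ≤ᶠ t) = eval ν ν′ s ℤ.≤ eval ν ν′ t
(ν , ν′) ⊨ (s =ᶠ t) = eval ν ν′ s ≡ eval ν ν′ t
(ν , ν′) ⊨ (k ∣ᶠ t) = (+ k) ℤ.∣ eval ν ν′ t
(ν , ν′) ⊨ (¬ᶠ φ)   = ¬ ((ν , ν′) ⊨ φ)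
(ν , ν′) ⊨ (φ ∧ᶠ ψ) = ((ν , ν′) ⊨ φ) × ((ν , ν′) ⊨ ψ)
(ν , ν′) ⊨ (φ ∨ᶠ ψ) = ((ν , ν′) ⊨ φ) ⊎ ((ν , ν′) ⊨ ψ)

------------------------------------------------------------------------
-- Integer programs

record Rule (n : ℕ) (Q : Set) : Set where
  constructor _─[_]→_
  field
    source : Q
    guard  : Formula n
    target : Q

-- The finite sets of variables and of control states are identified with
-- Fin #vars and Fin #states.
record IntegerProgram : Set where
  field
    #vars #states : ℕ

  Q : Set
  Q = Fin #states

  field
    q-init : Q
    Δ      : List (Rule #vars Q)

  Val : Set
  Val = Valuation #vars

  Config : Set
  Config = Q × Val

  infix 4 _⟶_

  _⟶_ : Rel Config 0ℓ
  (q , ν) ⟶ (q′ , ν′) = ∃[ R ] (q ─[ R ]→ q′) ∈ Δ × (ν , ν′) ⊨ R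

  record Run (k : ℕ) (start end : Config) : Set where
    field
      configs   : Fin (suc k) → Config
      starts-at : configs Fin.zero ≡ start
      ends-at   : configs (fromℕ k) ≡ end
      steps     : ∀ (i : Fin k) → configs (inject₁ i) ⟶ configs (Fin.suc i)

open IntegerProgram using (Q; Val; q-init; Run; _⟶_)

⟦_⟧⁺ : (P : IntegerProgram) → Q P → Q P → Rel (Val P) 0ℓ
⟦ P ⟧⁺ q q′ ν ν′ = ∃[ k ] 1 ≤ k × Run P k (q , ν) (q′ , ν′)

⟦_⟧* : (P : IntegerProgram) → Q P → Q P → Rel (Val P) 0ℓ
⟦ P ⟧* q q′ ν ν′ = ∃[ k ] Run P k (q , ν) (q′ , ν′)

⟦_⟧wnt : (P : IntegerProgram) → Q P → Pred (Val P) 0ℓ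
⟦ P ⟧wnt q ν = wnt (_⟶_ P) (q , ν)

⟦_⟧TInv : (P : IntegerProgram) → Q P → Q P → Rel (Val P) 0ℓ
⟦ P ⟧TInv q q′ ν ν′ =
  ⟦ P ⟧⁺ q q′ ν ν′ × image (⟦ P ⟧* (q-init P) q) U ν

{-# OPTIONS --safe #-}

-- Along an infinite run some control state q recurs, and any two of its visits
-- i < j are related by ⟦ P ⟧TInv q q, hence by some R q k.  A Ramsey argument
-- gives an infinite set of visits whose consecutive elements are related by the
-- same R q k.  Conversely, an infinite chain of non-empty runs from q to q,
-- preceded by a run from q-init to q, concatenates to an infinite run.
module Submission where

open import Defs
open import Axiom.ExcludedMiddle using (ExcludedMiddle)
open import Data.Fin.Base using (Fin)
open import Data.Nat.Base using (ℕ; _≤_)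
open import Data.Product.Base using (_×_)
open import Level using (0ℓ)
open import Relation.Binary.Core using (Rel; _⇒_; _⇔_)
open import Relation.Unary using (Pred; _⊆_; _≐_; ⋃)

open import Data.Empty using (⊥-elim)
open import Data.Fin.Base using (zero; suc; inject₁; fromℕ; toℕ)
open import Data.Fin.Properties using (toℕ-fromℕ; toℕ-inject₁)
open import Data.Nat.Base using (zero; suc; _+_; _∸_; _<_; s≤s; z≤n)
open import Data.Nat.Properties
  using (≤-refl; ≤-trans; <⇒≤; m<1+n⇒m<n∨m≡n; <-trans; m∸n+n≡m; m<n⇒0<n∸m; +-identityʳ)
open import Data.Product.Base using (∃; ∃-syntax; Σ-syntax; _,_; proj₁; proj₂)
open import Data.Sum.Base using (inj₁; inj₂)
open import Data.Unit.Base using (tt)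
open import Function.Base using (_∘_; _on_)
open import Relation.Binary.Construct.Closure.ReflexiveTransitive using (Star; ε; _◅_)
open import Relation.Binary.Construct.Intersection using (_∩_)
open import Relation.Binary.PropositionalEquality using (_≡_; refl; sym; cong; subst; subst₂)
open import Relation.Nullary.Decidable.Core using (yes; no)
open import Relation.Nullary.Negation.Core using (¬_)

module _ {A : Set} {T : Rel A 0ℓ} where

  wnt-coinduction : (I : Pred A 0ℓ) → (∀ {x} → I x → ∃[ y ] T x y × I y) → I ⊆ wnt T
  wnt-coinduction I next {x} Ix = proj₁ ∘ s , refl , λ i → proj₁ (proj₂ (next (proj₂ (s i))))
    where
    s : ℕ → ∃ I
    s zero    = x , Ix
    s (suc i) = let y , _ , Iy = next (proj₂ (s i)) in y , Iy

  -- The invariant is a finite path still to be walked to some `s i`. Once it is used up,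
  -- `segment i` supplies a genuine step and a new path to `s (suc i)`, so the walk never stalls.
  chain⇒wnt : (s : ℕ → A) → (∀ i → ∃[ y ] T (s i) y × Star T y (s (suc i))) →
              ∀ {x} → Star T x (s 0) → wnt T x
  chain⇒wnt s segment prefix = wnt-coinduction (λ x → ∃[ i ] Star T x (s i)) next (0 , prefix)
    where
    next : ∀ {x} → ∃[ i ] Star T x (s i) → ∃[ y ] T x y × ∃[ i ] Star T y (s i)
    next (i , ε)      = let y , t , ts = segment i in y , t , suc i , ts
    next (i , t ◅ ts) = _ , t , i , ts

  path⇒Star : ∀ k (f : Fin (suc k) → A) → (∀ i → T (f (inject₁ i)) (f (suc i))) →
              Star T (f zero) (f (fromℕ k))
  path⇒Star zero    f steps = ε
  path⇒Star (suc k) f steps = steps zero ◅ path⇒Star k (f ∘ suc) (steps ∘ suc)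

increasing⇒mono-< : (f : ℕ → ℕ) → (∀ i → f i < f (suc i)) → ∀ {i j} → i < j → f i < f j
increasing⇒mono-< f inc {i} {suc j} i<1+j with m<1+n⇒m<n∨m≡n i<1+j
... | inj₁ i<j  = <-trans (increasing⇒mono-< f inc i<j) (inc j)
... | inj₂ refl = inc j

-- If from some point on every i has a successor of colour 0, a chain of colour 0
-- exists.  Otherwise infinitely many i have none, and among these colour 0 does
-- not occur.
ramsey-chain : ExcludedMiddle 0ℓ → ∀ n (S : Fin n → Rel ℕ 0ℓ) →
               _<_ ⇒ ⋃ᴿ S → ∃[ k ] ∃ (wnt (_<_ ∩ S k))
ramsey-chain em zero    S colour with () ← proj₁ (colour {0} {1} (s≤s z≤n))
ramsey-chain em (suc n) S colour
  with em {∃[ N ] (∀ i → N ≤ i → ∃[ j ] (_<_ ∩ S zero) i j)}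
... | yes (N , next) = zero , N , wnt-coinduction (N ≤_) step ≤-refl
  where
  step : ∀ {i} → N ≤ i → ∃[ j ] (_<_ ∩ S zero) i j × N ≤ j
  step {i} N≤i = let j , i<j , Sij = next i N≤i in
                 j , (i<j , Sij) , ≤-trans N≤i (<⇒≤ i<j)
... | no ¬eventually = thin (wnt-coinduction Dead step (proj₂ (proj₂ (dead 0))))
  where
  Dead : Pred ℕ 0ℓ
  Dead i = ∀ j → ¬ (_<_ ∩ S zero) i j

  dead : ∀ N → ∃[ i ] N ≤ i × Dead i
  dead N with em {∃[ i ] N ≤ i × Dead i}
  ... | yes d = d
  ... | no ¬d = ⊥-elim (¬eventually (N , successor))
    where
    successor : ∀ i → N ≤ i → ∃[ j ] (_<_ ∩ S zero) i j
    successor i N≤i with em {∃[ j ] (_<_ ∩ S zero) i j}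
    ... | yes e = e
    ... | no ¬e = ⊥-elim (¬d (i , N≤i , λ j r → ¬e (j , r)))

  step : ∀ {i} → Dead i → ∃[ j ] (i < j × Dead i) × Dead j
  -- The bound `suc i` makes the next dead index strictly larger. `Dead i` is stored in the relation
  -- so that it can be read off every step of the chain.
  step {i} Di = let j , i<j , Dj = dead (suc i) in j , (i<j , Di) , Dj

  thin : ∀ {x} → wnt (λ i j → i < j × Dead i) x → ∃[ k ] ∃ (wnt (_<_ ∩ S k))
  thin (g , _ , g-steps) =
    let k , _ , f , _ , f-steps = ramsey-chain em n (λ k → S (suc k) on g) colour′
    in  suc k , g (f 0) , g ∘ f , refl ,
        λ i → g-mono (proj₁ (f-steps i)) , proj₂ (f-steps i)
    where
    g-mono : ∀ {i j} → i < j → g i < g j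
    g-mono = increasing⇒mono-< g (proj₁ ∘ g-steps)

    colour′ : _<_ ⇒ ⋃ᴿ (λ k → S (suc k) on g)
    colour′ {i} {j} i<j with colour (g-mono i<j)
    -- `g i` is dead, so no pair starting there has colour 0; the induction goes on with the other
    -- `n` colours.
    ... | zero  , r = ⊥-elim (proj₂ (g-steps i) (g j) (g-mono i<j , r))
    ... | suc k , r = k , r

-- A pair `i < j` gets the colour `c i` of its left end. On a monochromatic chain every index is the
-- left end of a step, so `c` is constant there.
pigeonhole-∞ : ExcludedMiddle 0ℓ → ∀ {n} (c : ℕ → Fin n) →
               ∃[ q ] Σ[ f ∈ (ℕ → ℕ) ] (∀ i → f i < f (suc i)) × (∀ i → c (f i) ≡ q)
pigeonhole-∞ em {n} c =
  let q , _ , f , _ , steps = ramsey-chain em n (λ q i _ → c i ≡ q) (λ {i} _ → c i , refl)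
  in  q , f , proj₁ ∘ steps , proj₂ ∘ steps

module _ (P : IntegerProgram) where
  open IntegerProgram P

  module _ (s : ℕ → Config) (steps : ∀ i → s i ⟶ s (suc i)) where

    -- With `k + i`, addition recurses on the position within the run, so the start and the target
    -- of each step agree by computation; only the end and the sources need transport.
    segment : ∀ k i → Run k (s i) (s (k + i))
    segment k i = record
      { configs   = λ l → s (toℕ l + i)
      ; starts-at = refl
      ; ends-at   = cong (λ m → s (m + i)) (toℕ-fromℕ k)
      ; steps     = λ l → subst (λ m → s (m + i) ⟶ s (suc (toℕ l + i)))
                                (sym (toℕ-inject₁ l)) (steps (toℕ l + i))
      }

    prefix* : ∀ i → ⟦ P ⟧* (proj₁ (s 0)) (proj₁ (s i)) (proj₂ (s 0)) (proj₂ (s i))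
    prefix* i = i , subst (λ m → Run i (s 0) (s m)) (+-identityʳ i) (segment i 0)

    segment⁺ : ∀ {i j} → i < j →
               ⟦ P ⟧⁺ (proj₁ (s i)) (proj₁ (s j)) (proj₂ (s i)) (proj₂ (s j))
    segment⁺ {i} {j} i<j = j ∸ i , m<n⇒0<n∸m i<j ,
      subst (λ m → Run (j ∸ i) (s i) (s m)) (m∸n+n≡m (<⇒≤ i<j)) (segment (j ∸ i) i)

  run⇒Star : ∀ {q q′ ν ν′} → ⟦ P ⟧* q q′ ν ν′ → Star _⟶_ (q , ν) (q′ , ν′)
  run⇒Star (k , r) = subst₂ (Star _⟶_) r.starts-at r.ends-at (path⇒Star k r.configs r.steps)
    where module r = Run r

  -- Length at least 1 yields the step that `chain⇒wnt` demands of each segment; the rest may be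
  -- empty.
  run⁺⇒step◅Star : ∀ {q q′ ν ν′} → ⟦ P ⟧⁺ q q′ ν ν′ →
                   ∃[ c ] (q , ν) ⟶ c × Star _⟶_ c (q′ , ν′)
  run⁺⇒step◅Star (suc k , _ , r) = r.configs (suc zero) ,
    subst (_⟶ r.configs (suc zero)) r.starts-at (r.steps zero) ,
    subst (Star _⟶_ _) r.ends-at (path⇒Star k (r.configs ∘ suc) (r.steps ∘ suc))
    where module r = Run r

  wnt-sound : ∀ {q} → preimage (⟦ P ⟧* q-init q) (wnt (⟦ P ⟧⁺ q q)) ⊆ ⟦ P ⟧wnt q-init
  wnt-sound {q} (_ , (s , refl , runs) , prefix) =
    chain⇒wnt (λ i → q , s i) (run⁺⇒step◅Star ∘ runs) (run⇒Star prefix)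

  wnt-complete : ExcludedMiddle 0ℓ → (p : Q → ℕ) (R : ∀ q → Fin (p q) → Rel Val 0ℓ) →
                 (∀ q → ⟦ P ⟧TInv q q ⇒ ⋃ᴿ (R q)) →
                 ⟦ P ⟧wnt q-init ⊆
                 ⋃ Q (λ q → preimage (⟦ P ⟧* q-init q) (⋃ (Fin (p q)) (λ k → wnt (R q k))))
  wnt-complete em p R cover {ν} (s , s₀ , steps) =
    let q , f , f-inc , at-q = pigeonhole-∞ em (proj₁ ∘ s)

        reach : ∀ i → ⟦ P ⟧* q-init q ν (proj₂ (s (f i)))
        reach i = subst₂ (λ c q′ → ⟦ P ⟧* (proj₁ c) q′ (proj₂ c) (proj₂ (s (f i))))
                         s₀ (at-q i) (prefix* s steps (f i))

        -- All pairs of visits are treated, not only consecutive ones, since the chain `g` chosen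
        -- below may skip visits.
        tinv : ∀ {i j} → i < j → ⟦ P ⟧TInv q q (proj₂ (s (f i))) (proj₂ (s (f j)))
        tinv {i} {j} i<j =
          subst₂ (λ q₁ q₂ → ⟦ P ⟧⁺ q₁ q₂ (proj₂ (s (f i))) (proj₂ (s (f j))))
                 (at-q i) (at-q j) (segment⁺ s steps (increasing⇒mono-< f f-inc i<j)) ,
          ν , tt , reach i

        k , _ , g , _ , g-steps =
          ramsey-chain em (p q) (λ k → R q k on (proj₂ ∘ s ∘ f)) (cover q ∘ tinv)
    in  q , proj₂ (s (f (g 0))) ,
        (k , proj₂ ∘ s ∘ f ∘ g , refl , proj₂ ∘ g-steps) , reach (g 0)

theorem6p2 :
    ExcludedMiddle 0ℓ →
    (P : IntegerProgram) →
    let open IntegerProgram P in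
    (P*♯ PTInv♯ : Q → Q → Rel Val 0ℓ) →
    (∀ q q′ → ⟦ P ⟧* q q′ ⇒ P*♯ q q′) →
    (∀ q q′ → ⟦ P ⟧TInv q q′ ⇒ PTInv♯ q q′) →
    (p : Q → ℕ) →
    (∀ q → 1 ≤ p q) →
    (R : ∀ q → Fin (p q) → Rel Val 0ℓ) →
    (∀ q → PTInv♯ q q ⇔ ⋃ᴿ (R q)) →
    let 𝒩 : Pred Val 0ℓ
        𝒩 = ⋃ Q (λ q → preimage (P*♯ q-init q) (⋃ (Fin (p q)) (λ k → wnt (R q k))))
    in
    (⟦ P ⟧wnt q-init ⊆ 𝒩)
    ×
    ((∀ q q′ → PTInv♯ q q′ ⇔ ⟦ P ⟧TInv q q′) →
     (∀ q q′ → P*♯ q q′ ⇔ ⟦ P ⟧* q q′) →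
     𝒩 ≐ ⟦ P ⟧wnt q-init)
theorem6p2 em P P*♯ PTInv♯ P*⊆ TInv⊆ p 1≤p R R-cover =
  complete , λ TInv≡ P*≡ →
    (λ { (q , ν′ , (k , s , s₀ , steps) , r) →
         wnt-sound P ( ν′
                     -- By exactness an `R q k` step is a `⟦ P ⟧TInv` pair, whose first component is
                     -- a non-empty run from `q` to `q`.
                     , (s , s₀ , λ i → proj₁ (proj₁ (TInv≡ q q) (proj₂ (R-cover q) (k , steps i))))
                     , proj₁ (P*≡ q-init q) r ) })
    , complete
  where
  open IntegerProgram P

  complete : ⟦ P ⟧wnt q-init ⊆
             ⋃ Q (λ q → preimage (P*♯ q-init q) (⋃ (Fin (p q)) (λ k → wnt (R q k))))
  complete w =
    -- The `R q k` cover `⟦ P ⟧TInv q q` by way of `PTInv♯`; the prefix is an actual run, enlarged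
    -- to `P*♯` only at the end.
    let q , ν′ , chain , r = wnt-complete P em p R (λ q t → proj₁ (R-cover q) (TInv⊆ q q t)) w
    in  q , ν′ , chain , P*⊆ q-init q r
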